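{- Let $G$ be a graph on $[n]$. Then $NC_G$ is a lattice if and only if $G$ is crossing closed. Moreover, if $G$ is crossing closed and $H,H'\in NC_G$, then $H\wedge H'=H\cap H'$ (the bond whose edge set is $E(H)\cap E(H')$), which is also the meet of $H$ and $H'$ in $L_G$; thus $NC_G$ is a meet-subsemilattice of $L_G$.
   Context: All graphs are finite simple graphs with vertex set $[n]=\{1,\dots,n\}$; edges are written $ij$ with $i<j$. Two edges $a_1a_2$ and $b_1b_2$ cross if $a_1<b_1<a_2<b_2$ or $b_1<a_1<b_2<a_2$. A spanning subgraph is identified with its edge set. A bond of $G$ is a spanning subgraph each of whose connected components is an induced subgraph of $G$. For a bond $H$, $\pi(H)$ is the set partition of $[n]$ whose blocks are the vertex sets of the connected components of $H$. A set partition is crossing if there are distinct blocks $B,B'$ and $a,c\in B$, $b,d\in B'$ with $a<b<c<d$, and noncrossing otherwise; a bond $H$ is noncrossing if $\pi(H)$ is. $L_G$ is the poset (bond lattice) of all bonds of $G$ ordered by inclusion of edge sets, and $NC_G$ is its subposet of noncrossing bonds. Two crossing edges $e,f$ are crossing closed if among all induced connected subgraphs of $G$ containing both $e$ and $f$ there is a unique one minimal with respect to containment; $G$ is crossing closed if every pair of crossing edges is crossing closed. -}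

module Defs where

open import Data.Bool.Base using (true)
open import Data.Fin.Base using (Fin; _<_)
open import Data.Fin.Properties using (_≟_)
open import Data.Fin.Subset using (Subset; Nonempty; _∈_; _⊆_)
open import Data.Fin.Subset.Properties using (_∈?_; ⊆-antisym)
open import Data.List.Base using (List; []; _∷_; allFin)
import Data.List.Membership.Propositional as List
open import Data.List.Membership.Propositional.Properties using (∈-allFin)
open import Data.List.Relation.Unary.Any using (here; there)
open import Data.Nat.Base using (ℕ)
open import Data.Product using (Σ; ∃; ∃₂; ∃!; _×_; _,_; proj₁; proj₂)
open import Data.Sum.Base using (_⊎_; inj₁; inj₂)
open import Data.Vec.Base using (tabulate)
open import Data.Vec.Properties using (lookup∘tabulate; lookup⇒[]=; []=⇒lookup)
open import Function.Base using (_∘_; id)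
open import Function.Bundles using (_⇔_; mk⇔; Equivalence)
open import Level using (Level; 0ℓ; _⊔_) renaming (suc to lsuc)
open import Relation.Binary.Bundles using (Poset)
open import Relation.Binary.Core using (Rel; _⇒_)
open import Relation.Binary.Definitions using (Decidable; Symmetric; Irreflexive)
open import Relation.Binary.Construct.Closure.ReflexiveTransitive
  using (Star; ε; _◅_; _◅◅_; reverse) renaming (map to mapStar)
import Relation.Binary.Construct.Interior.Symmetric as SymInterior
import Relation.Binary.Construct.On as On
open import Relation.Binary.Lattice.Structures using (IsLattice; IsMeetSemilattice)
open import Relation.Binary.PropositionalEquality using (_≡_; refl; trans)
  renaming (sym to ≡-sym)
open import Relation.Nullary using (¬_; Dec; yes; no; does)
open import Relation.Nullary.Decidable using (_×-dec_; _⊎-dec_; map′; dec-true)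
open import Relation.Unary using (Pred)

------------------------------------------------------------------------
-- Graphs

-- The vertex set [n] is Fin n with its usual order; only the order of the
-- vertices matters, so starting at 0 is harmless.
record Graph (n : ℕ) : Set₁ where
  field
    Adj    : Rel (Fin n) 0ℓ
    adj?   : Decidable Adj
    sym    : Symmetric Adj
    irrefl : Irreflexive _≡_ Adj

open Graph public using (Adj; adj?)

module _ {n : ℕ} where

  infix 4 _⊆ᴱ_

  _⊆ᴱ_ : Graph n → Graph n → Set
  H ⊆ᴱ G = Adj H ⇒ Adj G

  Connected : Graph n → Rel (Fin n) 0ℓ
  Connected G = Star (Adj G)

  -- The subgraph induced on W. It keeps the vertex type Fin n, so the vertices
  -- outside W become isolated; W itself records the actual vertex set.
  _[_] : Graph n → Subset n → Graph n
  G [ W ] = record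
    { Adj    = λ u v → u ∈ W × v ∈ W × Adj G u v
    ; adj?   = λ u v → u ∈? W ×-dec v ∈? W ×-dec adj? G u v
    ; sym    = λ (u∈W , v∈W , uv) → v∈W , u∈W , Graph.sym G uv
    ; irrefl = λ u≡v (_ , _ , uv) → Graph.irrefl G u≡v uv
    }

------------------------------------------------------------------------
-- Connectedness is decidable, so that components are values of type Subset n

module _ {n : ℕ} (G : Graph n) where

  private
    -- Joined by a walk whose intermediate vertices are taken from the list.
    Via : List (Fin n) → Rel (Fin n) 0ℓ
    Via []       u v = u ≡ v ⊎ Adj G u v
    Via (k ∷ ks) u v = Via ks u v ⊎ (Via ks u k × Via ks k v)

    via? : ∀ ks → Decidable (Via ks)
    via? []       u v = (u ≟ v) ⊎-dec adj? G u v
    via? (k ∷ ks) u v = via? ks u v ⊎-dec (via? ks u k ×-dec via? ks k v)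

    via-refl : ∀ ks {u} → Via ks u u
    via-refl []       = inj₁ refl
    via-refl (_ ∷ ks) = inj₁ (via-refl ks)

    via-adj : ∀ ks {u v} → Adj G u v → Via ks u v
    via-adj []       uv = inj₂ uv
    via-adj (_ ∷ ks) uv = inj₁ (via-adj ks uv)

    via-trans : ∀ {ks u m v} → m List.∈ ks → Via ks u m → Via ks m v → Via ks u v
    via-trans {_ ∷ _} (here refl) p q = inj₂ (to p , from q)
      where
      to : ∀ {k ks u} → Via (k ∷ ks) u k → Via ks u k
      to (inj₁ p)       = p
      to (inj₂ (p , _)) = p
      from : ∀ {k ks v} → Via (k ∷ ks) k v → Via ks k v
      from (inj₁ q)       = q
      from (inj₂ (_ , q)) = q
    via-trans {_ ∷ _} (there m∈) (inj₁ p)        (inj₁ q)        = inj₁ (via-trans m∈ p q)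
    via-trans {_ ∷ _} (there m∈) (inj₁ p)        (inj₂ (q , q′)) = inj₂ (via-trans m∈ p q , q′)
    via-trans {_ ∷ _} (there m∈) (inj₂ (p , p′)) (inj₁ q)        = inj₂ (p , via-trans m∈ p′ q)
    via-trans {_ ∷ _} (there m∈) (inj₂ (p , _))  (inj₂ (_ , q))  = inj₂ (p , q)

    via⇒connected : ∀ ks {u v} → Via ks u v → Connected G u v
    via⇒connected []       (inj₁ refl)    = ε
    via⇒connected []       (inj₂ uv)      = uv ◅ ε
    via⇒connected (_ ∷ ks) (inj₁ p)       = via⇒connected ks p
    via⇒connected (_ ∷ ks) (inj₂ (p , q)) = via⇒connected ks p ◅◅ via⇒connected ks q

    connected⇒via : ∀ {u v} → Connected G u v → Via (allFin n) u v
    connected⇒via ε        = via-refl (allFin n)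
    connected⇒via (uw ◅ p) = via-trans (∈-allFin _) (via-adj (allFin n) uw) (connected⇒via p)

  connected? : Decidable (Connected G)
  connected? u v = map′ (via⇒connected (allFin n)) connected⇒via (via? (allFin n) u v)

  connected-sym : Symmetric (Connected G)
  connected-sym = reverse (Graph.sym G)

  private
    witness : ∀ {A : Set} (A? : Dec A) → does A? ≡ true → A
    witness (yes a) _ = a
    witness (no _)  ()

  component : Fin n → Subset n
  component x = tabulate (does ∘ connected? x)

  ∈-component : ∀ x y → y ∈ component x ⇔ Connected G x y
  ∈-component x y = mk⇔ to from
    where
    to : y ∈ component x → Connected G x y
    to y∈ = witness (connected? x y)
      (trans (≡-sym (lookup∘tabulate (does ∘ connected? x) y)) ([]=⇒lookup y∈))
    from : Connected G x y → y ∈ component x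
    from p = lookup⇒[]= y (component x)
      (trans (lookup∘tabulate (does ∘ connected? x) y) (dec-true (connected? x y) p))

------------------------------------------------------------------------
-- Set partitions

record SetPartition (n : ℕ) : Set₁ where
  field
    Block    : Pred (Subset n) 0ℓ
    nonempty : ∀ {B} → Block B → Nonempty B
    cover    : ∀ x → ∃ λ B → Block B × x ∈ B
    disjoint : ∀ {B B′ x} → Block B → Block B′ → x ∈ B → x ∈ B′ → B ≡ B′

open SetPartition public using (Block)

module _ {n : ℕ} where

  Crossing : Pred (SetPartition n) 0ℓ
  Crossing P = ∃₂ λ B B′ → Block P B × Block P B′ × ¬ B ≡ B′ ×
    ∃₂ λ a b → ∃₂ λ c d →
      a ∈ B × c ∈ B × b ∈ B′ × d ∈ B′ × a < b × b < c × c < d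

  π : Graph n → SetPartition n
  π H = record
    { Block    = λ B → ∃ λ x → ∀ y → y ∈ B ⇔ Connected H x y
    ; nonempty = λ (x , B⇔) → x , Equivalence.from (B⇔ x) ε
    ; cover    = λ x → component H x , (x , ∈-component H x)
                     , Equivalence.from (∈-component H x x) ε
    ; disjoint = λ p q z∈B z∈B′ → ⊆-antisym (incl p q z∈B z∈B′) (incl q p z∈B′ z∈B)
    }
    where
    incl : ∀ {B B′ z} →
           (∃ λ x → ∀ y → y ∈ B ⇔ Connected H x y) →
           (∃ λ x → ∀ y → y ∈ B′ ⇔ Connected H x y) →
           z ∈ B → z ∈ B′ → B ⊆ B′
    incl (_ , B⇔) (_ , B′⇔) z∈B z∈B′ {y} y∈B = Equivalence.from (B′⇔ y)
      (Equivalence.to (B′⇔ _) z∈B′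
        ◅◅ connected-sym H (Equivalence.to (B⇔ _) z∈B)
        ◅◅ Equivalence.to (B⇔ y) y∈B)

------------------------------------------------------------------------
-- Bonds

-- For a component of the spanning subgraph H ⊆ G with vertex set B, being an
-- induced subgraph of G means H [ B ] = G [ B ]; only one inclusion is not
-- already implied by H ⊆ G.
record Bond {n : ℕ} (G : Graph n) : Set₁ where
  field
    graph    : Graph n
    subgraph : graph ⊆ᴱ G
    induced  : ∀ {B} → Block (π graph) B → G [ B ] ⊆ᴱ graph [ B ]

open Bond public using (graph)

module _ {n : ℕ} {G : Graph n} where

  Noncrossing : Pred (Bond G) 0ℓ
  Noncrossing H = ¬ Crossing (π (graph H))

  infixr 7 _∩_

  _∩_ : Bond G → Bond G → Bond G
  H ∩ H′ = record
    { graph    = H∩H′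
    ; subgraph = λ (uv , _) → Bond.subgraph H uv
    ; induced  = λ (x , B⇔) (u∈B , v∈B , uv) →
        let u~v = connected-sym H∩H′ (Equivalence.to (B⇔ _) u∈B)
                    ◅◅ Equivalence.to (B⇔ _) v∈B
        in u∈B , v∈B , restore H (mapStar proj₁ u~v) uv , restore H′ (mapStar proj₂ u~v) uv
    }
    where
    H∩H′ : Graph n
    H∩H′ = record
      { Adj    = λ u v → Adj (graph H) u v × Adj (graph H′) u v
      ; adj?   = λ u v → adj? (graph H) u v ×-dec adj? (graph H′) u v
      ; sym    = λ (p , q) → Graph.sym (graph H) p , Graph.sym (graph H′) q
      ; irrefl = λ u≡v (p , _) → Graph.irrefl (graph H) u≡v p
      }
    restore : ∀ (K : Bond G) {u v} → Connected (graph K) u v → Adj G u v → Adj (graph K) u v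
    restore K {u} {v} u~v uv = proj₂ (proj₂ (Bond.induced K (u , ∈-component (graph K) u)
      ( Equivalence.from (∈-component (graph K) u u) ε
      , Equivalence.from (∈-component (graph K) u v) u~v
      , uv)))

-- Two bonds are equal in these posets when they have the same edges.
L : ∀ {n} → Graph n → Poset (lsuc 0ℓ) 0ℓ 0ℓ
L G = SymInterior.poset {R = λ (H K : Bond G) → graph H ⊆ᴱ graph K}
  id (λ H⊆K K⊆M uv → K⊆M (H⊆K uv))

NC : ∀ {n} → Graph n → Poset (lsuc 0ℓ) 0ℓ 0ℓ
NC G = On.poset (L G) (proj₁ {B = Noncrossing})

------------------------------------------------------------------------
-- Crossing closed graphs

record Edge {n : ℕ} (G : Graph n) : Set where
  field
    lo hi : Fin n
    lo<hi : lo < hi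
    adj   : Adj G lo hi

module _ {n : ℕ} {G : Graph n} where

  open Edge

  Cross : Rel (Edge G) 0ℓ
  Cross e f = (lo e < lo f × lo f < hi e × hi e < hi f)
            ⊎ (lo f < lo e × lo e < hi f × hi f < hi e)

  _∋ᴱ_ : Subset n → Edge G → Set
  W ∋ᴱ e = lo e ∈ W × hi e ∈ W

-- An induced subgraph is determined by its vertex set, and containment of
-- induced subgraphs is containment of their vertex sets.
module _ {n : ℕ} (G : Graph n) where

  InducesConnected : Pred (Subset n) 0ℓ
  InducesConnected W = ∀ {u v} → u ∈ W → v ∈ W → Connected (G [ W ]) u v

  ConnectedContaining : Edge G → Edge G → Pred (Subset n) 0ℓ
  ConnectedContaining e f W = InducesConnected W × W ∋ᴱ e × W ∋ᴱ f

  Minimal : Pred (Subset n) 0ℓ → Pred (Subset n) 0ℓ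
  Minimal F W = F W × (∀ {W′} → F W′ → W′ ⊆ W → W′ ≡ W)

  CrossingClosedPair : Rel (Edge G) 0ℓ
  CrossingClosedPair e f = ∃! _≡_ (Minimal (ConnectedContaining e f))

  CrossingClosed : Set
  CrossingClosed = ∀ e f → Cross e f → CrossingClosedPair e f

------------------------------------------------------------------------
-- Order theory

module _ {a ℓ₁ ℓ₂ : Level} (P : Poset a ℓ₁ ℓ₂) where

  open Poset P

  IsLatticePoset : Set (a ⊔ ℓ₁ ⊔ ℓ₂)
  IsLatticePoset = ∃₂ λ _∨_ _∧_ → IsLattice _≈_ _≤_ _∨_ _∧_

  IsMeet : Carrier → Carrier → Carrier → Set (a ⊔ ℓ₂)
  IsMeet x y m = m ≤ x × m ≤ y × (∀ z → z ≤ x → z ≤ y → z ≤ m)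

  IsMeetSubsemilattice : ∀ {ℓ} → Pred Carrier ℓ → Set (a ⊔ ℓ₁ ⊔ ℓ₂ ⊔ ℓ)
  IsMeetSubsemilattice S = Σ (Carrier → Carrier → Carrier) λ _∧_ →
    IsMeetSemilattice _≈_ _≤_ _∧_ × (∀ {x y} → S x → S y → S (x ∧ y))

{-# OPTIONS --safe #-}

-- A graph has a noncrossing component partition iff the components of any two crossing edges
-- coincide (Jordan-type argument: a walk leaving an interval has a step that leaves it).
-- If G is crossing closed and e, f cross in an intersection of noncrossing bonds K_i, then in
-- each K_i both edges lie in one block; that block contains the unique minimal connected set M
-- containing e and f, so G[M] lies in every K_i and joins e to f in the intersection. Hence
-- noncrossing bonds are closed under arbitrary intersections (the empty one included), which
-- gives meets and, intersecting all upper bounds, joins. Conversely, if the join K of the bonds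
-- {e} and {f} exists, then its block through e contains e and f, and it is the least connected
-- set doing so: for any connected W containing e and f, the induced subgraph G[W] is a
-- noncrossing bond above {e} and {f}, hence above K.
module Submission where

open import Defs
open import Data.Fin.Base using (Fin; _<_; finToFun; funToFin)
open import Data.Fin.Properties using (_≟_; _<?_; <-cmp; <-trans; <-irrefl; all?; finToFun-funToFin)
open import Data.Fin.Subset using (Subset; _∈_; _⊆_; _⊂_; _∪_; ⁅_⁆)
open import Data.Fin.Subset.Induction using (⊂-wellFounded; Acc; acc)
open import Data.Fin.Subset.Properties
  using (_∈?_; _⊂?_; ⊆-antisym; anySubset?; nonempty?; x∈⁅x⁆; x∈⁅y⁆⇒x≡y; x∈p∪q⁺; x∈p∪q⁻)
open import Data.Nat.Base using (ℕ; _^_)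
open import Data.Product using (Σ; ∃; ∃₂; _×_; _,_; proj₁; proj₂)
open import Data.Sum.Base using (_⊎_; inj₁; inj₂)
open import Function.Bundles using (_⇔_; mk⇔; Equivalence)
open import Level using (0ℓ)
open import Relation.Binary.Bundles using (Poset)
open import Relation.Binary.Construct.Closure.ReflexiveTransitive
  using (Star; ε; _◅_; _◅◅_) renaming (map to mapStar)
open import Relation.Binary.Lattice.Structures using (IsLattice)
open import Relation.Binary.Definitions using (tri<; tri≈; tri>)
open import Relation.Binary.PropositionalEquality
  using (_≡_; refl; sym; trans; cong; subst)
open import Relation.Nullary using (¬_; Dec; yes; no; contradiction)
open import Relation.Nullary.Decidable using (_×-dec_; _→-dec_; map′; decidable-stable)
open import Relation.Unary using (Pred; Decidable)

-- Noncrossing graphs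

module _ {n : ℕ} where

  NoncrossingGraph : Graph n → Set
  NoncrossingGraph J = ¬ Crossing (π J)

module _ {n : ℕ} (J : Graph n) where

  CrossingEdges : (p r q s : Fin n) → Set
  CrossingEdges p r q s = p < r × r < q × q < s × Adj J p q × Adj J r s

  connected-edge : ∀ {u v} → Adj J u v → Connected J u v
  connected-edge uv = uv ◅ ε

  -- Induction along the walk. All its vertices lie in the component of `u`, so it never visits `l`
  -- or `h`, and the first step out of the open interval has to jump past an end.
  exits-interval : ∀ {l h u v} → l < u → u < h → ¬ (l < v × v < h) →
    ¬ Connected J u l → ¬ Connected J u h → Connected J u v →
    ∃₂ λ r s → Connected J u r × Adj J r s × l < r × r < h × (s < l ⊎ h < s)
  exits-interval l<u u<h v∉ _ _ ε = contradiction (l<u , u<h) v∉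
  exits-interval {l} {h} {u} l<u u<h v∉ u≁l u≁h (_◅_ {j = w} uw w~v)
    with <-cmp w l | <-cmp w h
  ... | tri< w<l _ _  | _ = u , w , ε , uw , l<u , u<h , inj₁ w<l
  ... | tri≈ _ refl _ | _ = contradiction (connected-edge uw) u≁l
  ... | tri> _ _ l<w  | tri> _ _ h<w  = u , w , ε , uw , l<u , u<h , inj₂ h<w
  ... | tri> _ _ l<w  | tri≈ _ refl _ = contradiction (connected-edge uw) u≁h
  ... | tri> _ _ l<w  | tri< w<h _ _
    with exits-interval l<w w<h v∉ (λ w~l → u≁l (uw ◅ w~l)) (λ w~h → u≁h (uw ◅ w~h)) w~v
  ...   | r , s , w~r , rest = r , s , uw ◅ w~r , rest

  -- Since `y` shares the component of `x`, the walk from `u` avoids both ends of the edge `xy`; the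
  -- step by which it leaves the interval crosses that edge.
  crossing-edges-from-edge : ∀ {x y u v} → Adj J x y → x < u → u < y → ¬ (x < v × v < y) →
    ¬ Connected J u x → Connected J u v →
    ∃₂ λ p r → ∃₂ λ q s → CrossingEdges p r q s × ¬ Connected J p r
  crossing-edges-from-edge {x} {y} {u} xy x<u u<y v∉ u≁x u~v
    with exits-interval x<u u<y v∉ u≁x (λ u~y → u≁x (u~y ◅◅ connected-edge (Graph.sym J xy))) u~v
  ... | r , s , u~r , rs , x<r , r<y , inj₁ s<x =
    s , x , r , y , (s<x , x<r , r<y , Graph.sym J rs , xy) ,
    λ s~x → u≁x (u~r ◅◅ rs ◅ s~x)
  ... | r , s , u~r , rs , x<r , r<y , inj₂ y<s =
    x , r , y , s , (x<r , r<y , y<s , xy , rs) ,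
    λ x~r → u≁x (u~r ◅◅ connected-sym J x~r)

  -- Two exits are combined. The walk from `c` to `a` leaves the interval between `b` and `d` by an
  -- edge `pq`, which has exactly one of `b` and `d` strictly between its ends. The walk joining `b`
  -- and `d` therefore leaves the interval spanned by `pq`.
  crossing-components⇒crossing-edges : ∀ {a b c d} → a < b → b < c → c < d →
    Connected J a c → Connected J b d → ¬ Connected J a b →
    ∃₂ λ p r → ∃₂ λ q s → CrossingEdges p r q s × ¬ Connected J p r
  crossing-components⇒crossing-edges {a} {b} {c} {d} a<b b<c c<d a~c b~d a≁b
    with exits-interval b<c c<d (λ (b<a , _) → <-irrefl refl (<-trans a<b b<a))
           (λ c~b → a≁b (a~c ◅◅ c~b))
           (λ c~d → a≁b (a~c ◅◅ c~d ◅◅ connected-sym J b~d))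
           (connected-sym J a~c)
  ... | p , q , c~p , pq , b<p , p<d , inj₁ q<b =
    crossing-edges-from-edge (Graph.sym J pq) q<b b<p
      (λ (_ , d<p) → <-irrefl refl (<-trans p<d d<p))
      (λ b~q → a≁b (a~c ◅◅ c~p ◅◅ pq ◅ connected-sym J b~q))
      b~d
  ... | p , q , c~p , pq , b<p , p<d , inj₂ d<q =
    crossing-edges-from-edge pq p<d d<q
      (λ (p<b , _) → <-irrefl refl (<-trans p<b b<p))
      (λ d~p → a≁b (a~c ◅◅ c~p ◅◅ connected-sym J (b~d ◅◅ d~p)))
      (connected-sym J b~d)

  -- Together with `noncrossing⇒edges` this trades blocks for a condition on four vertices, which
  -- can be decided by search and transferred between graphs with the same edges.
  edges⇒noncrossing : (∀ {p r q s} → CrossingEdges p r q s → Connected J p r) →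
    NoncrossingGraph J
  edges⇒noncrossing joined (B , B′ , x , y , B≢B′ , a , b , c , d ,
                            a∈B , c∈B , b∈B′ , d∈B′ , a<b , b<c , c<d)
    with crossing-components⇒crossing-edges a<b b<c c<d (inBlock x a∈B c∈B) (inBlock y b∈B′ d∈B′)
           (λ a~b → B≢B′ (SetPartition.disjoint (π J) x y
             (Equivalence.from (proj₂ x b) (Equivalence.to (proj₂ x a) a∈B ◅◅ a~b)) b∈B′))
    where
    inBlock : ∀ {C u v} → Block (π J) C → u ∈ C → v ∈ C → Connected J u v
    inBlock (_ , C⇔) u∈C v∈C =
      connected-sym J (Equivalence.to (C⇔ _) u∈C) ◅◅ Equivalence.to (C⇔ _) v∈C
  ... | _ , _ , _ , _ , cross , p≁r = p≁r (joined cross)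

  noncrossing⇒edges : NoncrossingGraph J →
    ∀ {p r q s} → CrossingEdges p r q s → Connected J p r
  noncrossing⇒edges nc {p} {r} {q} {s} (p<r , r<q , q<s , pq , rs) =
    decidable-stable (connected? J p r) λ p≁r → nc
      ( component J p , component J r
      , (p , ∈-component J p) , (r , ∈-component J r)
      , (λ C≡C′ → p≁r (Equivalence.to (∈-component J p r)
          (subst (r ∈_) (sym C≡C′) (Equivalence.from (∈-component J r r) ε))))
      , p , r , q , s
      , Equivalence.from (∈-component J p p) ε
      , Equivalence.from (∈-component J p q) (connected-edge pq)
      , Equivalence.from (∈-component J r r) ε
      , Equivalence.from (∈-component J r s) (connected-edge rs)
      , p<r , r<q , q<s)

  noncrossing? : Dec (NoncrossingGraph J)
  noncrossing? = map′ (λ joined → edges⇒noncrossing λ {p} {r} {q} {s} → joined p r q s)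
    (λ nc p r q s → noncrossing⇒edges nc)
    (all? λ p → all? λ r → all? λ q → all? λ s →
      (p <? r ×-dec r <? q ×-dec q <? s ×-dec adj? J p q ×-dec adj? J r s)
        →-dec connected? J p r)

module _ {n : ℕ} where

  infix 4 _⊆ᴱ?_

  _⊆ᴱ?_ : (H K : Graph n) → Dec (H ⊆ᴱ K)
  H ⊆ᴱ? K = map′ (λ sub {u} {v} → sub u v) (λ sub u v → sub)
    (all? λ u → all? λ v → adj? H u v →-dec adj? K u v)

  component-cong : (J : Graph n) → ∀ {u v} → Connected J u v → component J u ≡ component J v
  component-cong J {u} {v} u~v = ⊆-antisym
    (λ {x} x∈ → Equivalence.from (∈-component J v x)
      (connected-sym J u~v ◅◅ Equivalence.to (∈-component J u x) x∈))
    (λ {x} x∈ → Equivalence.from (∈-component J u x)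
      (u~v ◅◅ Equivalence.to (∈-component J v x) x∈))

-- Induced subgraphs

module _ {n : ℕ} (G : Graph n) where

  connected-endpoint-∈ : ∀ {W u v} → u ∈ W → Connected (G [ W ]) u v → v ∈ W
  connected-endpoint-∈ u∈W ε = u∈W
  connected-endpoint-∈ _ ((_ , w∈W , _) ◅ w~v) = connected-endpoint-∈ w∈W w~v

  component-inducesConnected : ∀ {K x} → K ⊆ᴱ G → InducesConnected G (component K x)
  component-inducesConnected {K} {x} K⊆G u∈C v∈C = walk (reaches u∈C)
    (connected-sym K (reaches u∈C) ◅◅ reaches v∈C)
    where
    reaches : ∀ {w} → w ∈ component K x → Connected K x w
    reaches = Equivalence.to (∈-component K x _)
    reached : ∀ {w} → Connected K x w → w ∈ component K x
    reached = Equivalence.from (∈-component K x _)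
    walk : ∀ {u v} → Connected K x u → Connected K u v → Connected (G [ component K x ]) u v
    walk _ ε = ε
    walk x~u (uw ◅ w~v) = (reached x~u , reached x~w , K⊆G uw) ◅ walk x~w w~v
      where x~w = x~u ◅◅ connected-edge K uw

  connectedContaining? : ∀ e f → Decidable (ConnectedContaining G e f)
  connectedContaining? e f W =
    map′ (λ conn {u} {v} u∈W v∈W → conn u v u∈W v∈W) (λ conn u v → conn)
      (all? λ u → all? λ v → u ∈? W →-dec (v ∈? W →-dec connected? (G [ W ]) u v))
    ×-dec (Edge.lo e ∈? W ×-dec Edge.hi e ∈? W)
    ×-dec (Edge.lo f ∈? W ×-dec Edge.hi f ∈? W)

  -- Descent along strict inclusion, with a finite search for a smaller set at each stage. It links
  -- `CrossingClosedPair`, which speaks only of minimal sets, to the blocks of a bond, which need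
  -- not be minimal.
  minimal-below : ∀ {F : Pred (Subset n) 0ℓ} → Decidable F →
    ∀ {C} → F C → ∃ λ M → Minimal G F M × M ⊆ C
  minimal-below {F} F? {C} = go (⊂-wellFounded C)
    where
    go : ∀ {C} → Acc _⊂_ C → F C → ∃ λ M → Minimal G F M × M ⊆ C
    go {C} (acc rec) FC with anySubset? (λ W → F? W ×-dec W ⊂? C)
    ... | yes (W , FW , W⊂C@(W⊆C , _)) =
      let M , min , M⊆W = go (rec W⊂C) FW in M , min , λ x∈M → W⊆C (M⊆W x∈M)
    ... | no ∄W = C , (FC , λ {W} FW W⊆C → ⊆-antisym W⊆C λ {x} x∈C →
      decidable-stable (x ∈? W) λ x∉W → ∄W (W , FW , W⊆C , x , x∈C , x∉W)) , λ x∈C → x∈C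

-- Bonds

module _ {n : ℕ} {G : Graph n} where

  bond-closed : (K : Bond G) → ∀ {u v} →
    Connected (graph K) u v → Adj G u v → Adj (graph K) u v
  bond-closed K {u} {v} u~v uv = proj₂ (proj₂ (Bond.induced K (u , ∈-component (graph K) u)
    ( Equivalence.from (∈-component (graph K) u u) ε
    , Equivalence.from (∈-component (graph K) u v) u~v
    , uv)))

  -- Converse of `bond-closed`: bonds are the subgraphs that contain every edge of `G` between
  -- vertices they connect, that is, the flats of the graphic matroid.
  closed⇒bond : (J : Graph n) → J ⊆ᴱ G →
    (∀ {u v} → Connected J u v → Adj G u v → Adj J u v) → Bond G
  closed⇒bond J J⊆G closed = record
    { graph    = J
    ; subgraph = J⊆G
    ; induced  = λ (x , B⇔) (u∈B , v∈B , uv) → u∈B , v∈B ,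
        closed (connected-sym J (Equivalence.to (B⇔ _) u∈B) ◅◅ Equivalence.to (B⇔ _) v∈B) uv
    }

  inducedBond : Subset n → Bond G
  inducedBond W = closed⇒bond (G [ W ]) (λ (_ , _ , uv) → uv) closed
    where
    closed : ∀ {u v} → Connected (G [ W ]) u v → Adj G u v → Adj (G [ W ]) u v
    closed ε uu = contradiction uu (Graph.irrefl G refl)
    closed ((u∈W , w∈W , _) ◅ w~v) uv = u∈W , connected-endpoint-∈ G w∈W w~v , uv

  -- Every edge has both ends in `W`, which is a single component, so any two crossing edges are
  -- already joined.
  inducedBond-noncrossing : ∀ {W} → InducesConnected G W → Noncrossing (inducedBond W)
  inducedBond-noncrossing {W} conn = edges⇒noncrossing (G [ W ])
    λ (_ , _ , _ , (p∈W , _) , (r∈W , _)) → conn p∈W r∈W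

  -- The hypotheses pin `J` down as the intersection of `G` with all `K i`. It is supplied from
  -- outside because a graph has decidable adjacency, which an arbitrary family does not provide.
  intersection-noncrossing : CrossingClosed G →
    ∀ {a} {I : Set a} (K : I → Bond G) → (∀ i → Noncrossing (K i)) →
    (J : Graph n) → J ⊆ᴱ G → (∀ i → J ⊆ᴱ graph (K i)) →
    (∀ {u v} → Adj G u v → (∀ i → Adj (graph (K i)) u v) → Adj J u v) →
    NoncrossingGraph J
  intersection-noncrossing cc K nc J J⊆G J⊆K meets = edges⇒noncrossing J joined
    where
    joined : ∀ {p r q s} → CrossingEdges J p r q s → Connected J p r
    joined {p} {r} {q} {s} (p<r , r<q , q<s , pq , rs) =
      let M , ((conn , (p∈M , _) , (r∈M , _)) , _) , unique = cc e f (inj₁ (p<r , r<q , q<s))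
      in mapStar (G[M]⊆J unique) (conn p∈M r∈M)
      where
      e f : Edge G
      e = record { lo<hi = <-trans p<r r<q ; adj = J⊆G pq }
      f = record { lo<hi = <-trans r<q q<s ; adj = J⊆G rs }

      UniqueMinimal : Pred (Subset n) 0ℓ
      UniqueMinimal M = ∀ {M′} → Minimal G (ConnectedContaining G e f) M′ → M ≡ M′

      C : ∀ i → Subset n
      C i = component (graph (K i)) p

      reached : ∀ i {x} → Connected (graph (K i)) p x → x ∈ C i
      reached i = Equivalence.from (∈-component (graph (K i)) p _)

      p~r : ∀ i → Connected (graph (K i)) p r
      p~r i = noncrossing⇒edges (graph (K i)) (nc i) (p<r , r<q , q<s , J⊆K i pq , J⊆K i rs)

      -- The block `C i` is connected and contains both edges, so some minimal set lies inside it;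
      -- by uniqueness that set is `M`, whatever `i` is.
      M⊆C : ∀ {M} → UniqueMinimal M → ∀ i → M ⊆ C i
      M⊆C unique i with minimal-below G (connectedContaining? G e f)
        ( component-inducesConnected G (Bond.subgraph (K i))
        , (reached i ε , reached i (connected-edge (graph (K i)) (J⊆K i pq)))
        , (reached i (p~r i) , reached i (p~r i ◅◅ connected-edge (graph (K i)) (J⊆K i rs))))
      ... | M′ , min , M′⊆C with unique min
      ...   | refl = M′⊆C

      G[M]⊆J : ∀ {M} → UniqueMinimal M → (G [ M ]) ⊆ᴱ J
      G[M]⊆J unique (u∈M , v∈M , uv) = meets uv λ i → bond-closed (K i)
        (connected-sym (graph (K i)) (Equivalence.to (∈-component (graph (K i)) p _) (M⊆C unique i u∈M))
          ◅◅ Equivalence.to (∈-component (graph (K i)) p _) (M⊆C unique i v∈M))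
        uv

  ∩-noncrossing : CrossingClosed G → (H H′ : Bond G) →
    Noncrossing H → Noncrossing H′ → Noncrossing (H ∩ H′)
  -- The family consists of all noncrossing bonds above `H ∩ H′`. Both `H` and `H′` are members, so
  -- its common edges are those of `H ∩ H′`.
  ∩-noncrossing cc H H′ nc nc′ = intersection-noncrossing cc {I = Σ (Bond G) (λ K →
      Noncrossing K × graph (H ∩ H′) ⊆ᴱ graph K)} proj₁ (λ (_ , ncK , _) → ncK)
    (graph (H ∩ H′)) (Bond.subgraph (H ∩ H′)) (λ (_ , _ , sub) → sub)
    (λ _ all → all (H , nc , proj₁) , all (H′ , nc′ , proj₂))

-- Enumeration of bonds

-- Every bond arises from a vertex labelling, by keeping the edges of G whose ends have equal
-- labels; labellings are indexed by Fin (n ^ n), so one can search through all bonds.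
module _ {n : ℕ} (G : Graph n) where

  labelledBond : (Fin n → Fin n) → Bond G
  labelledBond f = closed⇒bond
    (record
      { Adj    = λ u v → Adj G u v × f u ≡ f v
      ; adj?   = λ u v → adj? G u v ×-dec f u ≟ f v
      ; sym    = λ (uv , eq) → Graph.sym G uv , sym eq
      ; irrefl = λ u≡v (uv , _) → Graph.irrefl G u≡v uv
      })
    proj₁ (λ u~v uv → uv , constant u~v)
    where
    constant : ∀ {u v} → Star (λ u v → Adj G u v × f u ≡ f v) u v → f u ≡ f v
    constant ε = refl
    constant ((_ , eq) ◅ w~v) = trans eq (constant w~v)

  bondAt : Fin (n ^ n) → Bond G
  bondAt k = labelledBond (finToFun k)

  -- The second argument is a default value for the empty set.
  representative : Subset n → Fin n → Fin n
  representative S x with nonempty? S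
  ... | yes (y , _) = y
  ... | no _        = x

  representative-∈ : ∀ {S x} → x ∈ S → representative S x ∈ S
  representative-∈ {S} x∈S with nonempty? S
  ... | yes (_ , y∈S) = y∈S
  ... | no S-empty    = contradiction (_ , x∈S) S-empty

  -- `componentLabel` passes each vertex as its own default, so connected vertices get equal labels
  -- only because the default is never returned.
  representative-irrelevant : ∀ {S x y} → x ∈ S → representative S x ≡ representative S y
  representative-irrelevant {S} x∈S with nonempty? S
  ... | yes _      = refl
  ... | no S-empty = contradiction (_ , x∈S) S-empty

  module _ (K : Bond G) where

    componentLabel : Fin n → Fin n
    componentLabel u = representative (component (graph K) u) u

    index : Fin (n ^ n)
    index = funToFin componentLabel

    connected-to-label : ∀ u → Connected (graph K) u (componentLabel u)
    connected-to-label u = Equivalence.to (∈-component (graph K) u _)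
      (representative-∈ (Equivalence.from (∈-component (graph K) u u) ε))

    bond⊆bondAt-index : graph K ⊆ᴱ graph (bondAt index)
    bond⊆bondAt-index {u} {v} uv = Bond.subgraph K uv ,
      trans (finToFun-funToFin componentLabel u)
        (trans same (sym (finToFun-funToFin componentLabel v)))
      where
      same : componentLabel u ≡ componentLabel v
      same = trans
        (representative-irrelevant (Equivalence.from (∈-component (graph K) u u) ε))
        (cong (λ S → representative S v) (component-cong (graph K) (connected-edge (graph K) uv)))

    -- Each vertex is connected in `K` to its label, so equal labels connect `u` and `v`, and a bond
    -- contains every edge of `G` between connected vertices.
    bondAt-index⊆bond : graph (bondAt index) ⊆ᴱ graph K
    bondAt-index⊆bond {u} {v} (uv , eq) = bond-closed K
      (connected-to-label u ◅◅ subst (λ x → Connected (graph K) x v) (sym same)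
        (connected-sym (graph K) (connected-to-label v))) uv
      where
      same : componentLabel u ≡ componentLabel v
      same = trans (sym (finToFun-funToFin componentLabel u))
        (trans eq (finToFun-funToFin componentLabel v))

    bondAt-index-noncrossing : Noncrossing K → Noncrossing (bondAt index)
    bondAt-index-noncrossing nc = edges⇒noncrossing (graph (bondAt index))
      λ (p<r , r<q , q<s , pq , rs) → mapStar bond⊆bondAt-index
        (noncrossing⇒edges (graph K) nc
          (p<r , r<q , q<s , bondAt-index⊆bond pq , bondAt-index⊆bond rs))

-- Joins of noncrossing bonds

module _ {n : ℕ} {G : Graph n} (H H′ : Bond G) where

  UpperBound : Pred (Bond G) 0ℓ
  UpperBound K = Noncrossing K × graph H ⊆ᴱ graph K × graph H′ ⊆ᴱ graph K

  upperBound? : Decidable UpperBound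
  upperBound? K =
    noncrossing? (graph K) ×-dec graph H ⊆ᴱ? graph K ×-dec graph H′ ⊆ᴱ? graph K

  -- The intersection of all upper bounds. Quantifying over indices instead of bonds keeps adjacency
  -- in `Set` and decidable by finite search.
  joinGraph : Graph n
  joinGraph = record
    { Adj    = λ u v → Adj G u v × (∀ k → UpperBound (bondAt G k) → Adj (graph (bondAt G k)) u v)
    ; adj?   = λ u v → adj? G u v ×-dec
        all? (λ k → upperBound? (bondAt G k) →-dec adj? (graph (bondAt G k)) u v)
    ; sym    = λ (uv , all) → Graph.sym G uv , λ k ub → Graph.sym (graph (bondAt G k)) (all k ub)
    ; irrefl = λ u≡v (uv , _) → Graph.irrefl G u≡v uv
    }

  joinBond : Bond G
  joinBond = closed⇒bond joinGraph proj₁ λ u~v uv → uv , λ k ub →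
    bond-closed (bondAt G k) (mapStar (λ (_ , all) → all k ub) u~v) uv

  joinBond-noncrossing : CrossingClosed G → Noncrossing joinBond
  joinBond-noncrossing cc = intersection-noncrossing cc
    {I = ∃ λ k → UpperBound (bondAt G k)} (λ (k , _) → bondAt G k) (λ (_ , nc , _) → nc)
    joinGraph proj₁ (λ (k , ub) (_ , all) → all k ub) (λ uv all → uv , λ k ub → all (k , ub))

  ⊆-joinBondˡ : graph H ⊆ᴱ joinGraph
  ⊆-joinBondˡ uv = Bond.subgraph H uv , λ _ (_ , H⊆ , _) → H⊆ uv

  ⊆-joinBondʳ : graph H′ ⊆ᴱ joinGraph
  ⊆-joinBondʳ uv = Bond.subgraph H′ uv , λ _ (_ , _ , H′⊆) → H′⊆ uv

  -- An arbitrary upper bound has the same edges as the enumerated bond at its index, which is one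
  -- of the bonds intersected.
  joinBond-least : ∀ K → UpperBound K → joinGraph ⊆ᴱ graph K
  joinBond-least K (nc , H⊆K , H′⊆K) (_ , all) = bondAt-index⊆bond G K (all (index G K)
    ( bondAt-index-noncrossing G K nc
    , (λ uv → bond⊆bondAt-index G K (H⊆K uv))
    , (λ uv → bond⊆bondAt-index G K (H′⊆K uv))))

-- Crossing pairs with a join

module _ {n : ℕ} {G : Graph n} where

  open Edge

  ends : Edge G → Subset n
  ends e = ⁅ lo e ⁆ ∪ ⁅ hi e ⁆

  lo∈ends : ∀ e → lo e ∈ ends e
  lo∈ends e = x∈p∪q⁺ (inj₁ (x∈⁅x⁆ (lo e)))

  hi∈ends : ∀ e → hi e ∈ ends e
  hi∈ends e = x∈p∪q⁺ (inj₂ (x∈⁅x⁆ (hi e)))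

  ends⊆ : ∀ e {W} → W ∋ᴱ e → ends e ⊆ W
  ends⊆ e (lo∈W , hi∈W) x∈ with x∈p∪q⁻ ⁅ lo e ⁆ ⁅ hi e ⁆ x∈
  ... | inj₁ x∈lo rewrite x∈⁅y⁆⇒x≡y (lo e) x∈lo = lo∈W
  ... | inj₂ x∈hi rewrite x∈⁅y⁆⇒x≡y (hi e) x∈hi = hi∈W

  ends-inducesConnected : ∀ e → InducesConnected G (ends e)
  ends-inducesConnected e u∈ v∈ = connected-sym (G [ ends e ]) (fromLo u∈) ◅◅ fromLo v∈
    where
    fromLo : ∀ {u} → u ∈ ends e → Connected (G [ ends e ]) (lo e) u
    fromLo u∈ with x∈p∪q⁻ ⁅ lo e ⁆ ⁅ hi e ⁆ u∈
    ... | inj₁ u∈lo rewrite x∈⁅y⁆⇒x≡y (lo e) u∈lo = ε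
    ... | inj₂ u∈hi rewrite x∈⁅y⁆⇒x≡y (hi e) u∈hi = (lo∈ends e , hi∈ends e , adj e) ◅ ε

  -- The bond whose only edge is `e`: `G` is simple, so it has no other edge on these two vertices.
  edgeBond : Edge G → Poset.Carrier (NC G)
  edgeBond e = inducedBond (ends e) , inducedBond-noncrossing {G = G} (ends-inducesConnected e)

  edgeBond⊆ : ∀ e {W} → W ∋ᴱ e → graph (proj₁ (edgeBond e)) ⊆ᴱ (G [ W ])
  edgeBond⊆ e W∋e (u∈ , v∈ , uv) = ends⊆ e W∋e u∈ , ends⊆ e W∋e v∈ , uv

  edgeBond∋ : ∀ e → Adj (graph (proj₁ (edgeBond e))) (lo e) (hi e)
  edgeBond∋ e = lo∈ends e , hi∈ends e , adj e

  crossing-connected : (K : Graph n) → NoncrossingGraph K → ∀ e f → Cross {G = G} e f →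
    Adj K (lo e) (hi e) → Adj K (lo f) (hi f) → Connected K (lo e) (lo f)
  crossing-connected K nc e f (inj₁ (x , y , z)) eK fK =
    noncrossing⇒edges K nc (x , y , z , eK , fK)
  crossing-connected K nc e f (inj₂ (x , y , z)) eK fK =
    connected-sym K (noncrossing⇒edges K nc (x , y , z , fK , eK))

  edge-join⇒crossingClosedPair : ∀ e f → Cross e f → (K : Poset.Carrier (NC G)) →
    (let open Poset (NC G) using (_≤_) in
     edgeBond e ≤ K × edgeBond f ≤ K × (∀ M → edgeBond e ≤ M → edgeBond f ≤ M → K ≤ M)) →
    CrossingClosedPair G e f
  edge-join⇒crossingClosedPair e f e×f (K , nc) (e≤K , f≤K , least) =
    C , (C-containing , λ F W⊆C → ⊆-antisym W⊆C (C⊆ F)) ,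
    -- `C` lies inside every competitor, so the minimality of a competitor forces it to equal `C`.
    λ (F , min) → min C-containing (C⊆ F)
    where
    C : Subset n
    C = component (graph K) (lo e)

    reached : ∀ {x} → Connected (graph K) (lo e) x → x ∈ C
    reached = Equivalence.from (∈-component (graph K) (lo e) _)

    eK : Adj (graph K) (lo e) (hi e)
    eK = e≤K (edgeBond∋ e)

    fK : Adj (graph K) (lo f) (hi f)
    fK = f≤K (edgeBond∋ f)

    e~f : Connected (graph K) (lo e) (lo f)
    e~f = crossing-connected (graph K) nc e f e×f eK fK

    C-containing : ConnectedContaining G e f C
    C-containing = component-inducesConnected G (Bond.subgraph K)
      , (reached ε , reached (eK ◅ ε)) , (reached e~f , reached (e~f ◅◅ fK ◅ ε))

    -- As `K` lies below the bond induced by `W`, a walk in `K` from `lo e` is a walk in `G [ W ]`,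
    -- and such a walk cannot leave `W`.
    C⊆ : ∀ {W} → ConnectedContaining G e f W → C ⊆ W
    C⊆ {W} (conn , W∋e , W∋f) x∈C = connected-endpoint-∈ G (proj₁ W∋e)
      (mapStar
        (least (inducedBond W , inducedBond-noncrossing {G = G} conn)
          (edgeBond⊆ e W∋e) (edgeBond⊆ f W∋f))
        (Equivalence.to (∈-component (graph K) (lo e) _) x∈C))

theorem2p6 : (n : ℕ) (G : Graph n) →
    (IsLatticePoset (NC G) ⇔ CrossingClosed G) ×
    (CrossingClosed G →
    ((H H′ : Poset.Carrier (NC G)) →
    Σ (Noncrossing (proj₁ H ∩ proj₁ H′)) λ nc →
    IsMeet (NC G) H H′ (proj₁ H ∩ proj₁ H′ , nc) ×
    IsMeet (L G) (proj₁ H) (proj₁ H′) (proj₁ H ∩ proj₁ H′)) ×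
    IsMeetSubsemilattice (L G) Noncrossing)
theorem2p6 n G = mk⇔ lattice⇒closed closed⇒lattice , λ cc →
  (λ (H , nc) (H′ , nc′) → ∩-noncrossing cc H H′ nc nc′
    -- The order of `NC G` is restricted from `L G`, so one argument proves the meet property in
    -- both posets.
    , (proj₁ , proj₂ , λ _ K⊆H K⊆H′ uv → K⊆H uv , K⊆H′ uv)
    , (proj₁ , proj₂ , λ _ K⊆H K⊆H′ uv → K⊆H uv , K⊆H′ uv))
  , _∩_
  , record
    { isPartialOrder = Poset.isPartialOrder (L G)
    ; infimum = λ _ _ → proj₁ , proj₂ , λ _ K⊆H K⊆H′ uv → K⊆H uv , K⊆H′ uv
    }
  , λ {H} {H′} → ∩-noncrossing cc H H′
  where
  lattice⇒closed : IsLatticePoset (NC G) → CrossingClosed G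
  lattice⇒closed (_∨_ , _ , isLattice) e f e×f = edge-join⇒crossingClosedPair e f e×f
    (edgeBond e ∨ edgeBond f) (IsLattice.supremum isLattice (edgeBond e) (edgeBond f))

  closed⇒lattice : CrossingClosed G → IsLatticePoset (NC G)
  closed⇒lattice cc =
    (λ (H , _) (H′ , _) → joinBond H H′ , joinBond-noncrossing H H′ cc) ,
    (λ (H , nc) (H′ , nc′) → H ∩ H′ , ∩-noncrossing cc H H′ nc nc′) ,
    record
      { isPartialOrder = Poset.isPartialOrder (NC G)
      ; supremum = λ (H , _) (H′ , _) → ⊆-joinBondˡ H H′ , ⊆-joinBondʳ H H′
          , λ (K , nc) H⊆K H′⊆K → joinBond-least H H′ K (nc , H⊆K , H′⊆K)
      ; infimum = λ _ _ → proj₁ , proj₂ , λ _ K⊆H K⊆H′ uv → K⊆H uv , K⊆H′ uv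
      }
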